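{- Let $n\ge 4$ be an even integer and let $k\ge 3$ and $m\ge 2$ be integers. Then the metric dimension of $(C_n\square P_k)\square P_m$ is $4$.
   Context: All graphs are finite and connected; $d(u,v)$ is the shortest-path distance. $C_n$ is the cycle on $n$ vertices and $P_k$ the path on $k$ vertices. The cartesian product $G\square H$ has vertex set $V(G)\times V(H)$, with $(g_1,h_1)$ adjacent to $(g_2,h_2)$ iff either $h_1=h_2$ and $g_1g_2\in E(G)$, or $g_1=g_2$ and $h_1h_2\in E(H)$. For an ordered set $Q=\{q_1,\dots,q_l\}$ of vertices, $r(x|Q)=(d(x,q_1),\dots,d(x,q_l))$. $Q$ is a resolving set of $G$ if any two distinct vertices of $G$ have distinct vectors $r(\cdot|Q)$; the metric dimension is the minimum size of a resolving set. -}

module Defs where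

open import Data.Fin using (Fin; zero; suc; toℕ)
open import Data.Fin.Properties as Fin using (any?; *↔×)
open import Data.List using (List; length; map)
open import Data.List.Relation.Unary.Unique.Propositional using (Unique)
open import Data.Nat using (ℕ; zero; suc; _+_; _*_; _≤_; _≤?_; _<_; s≤s; ∣_-_∣; _≟_)
open import Data.Nat.Properties using (∣-∣-comm; ∣n-n∣≡0; ≤-refl; ≤-pred; m≤n⇒m<n∨m≡n; ≮⇒≥)
open import Data.Product using (∃; ∃-syntax; _×_; _,_; proj₁)
open import Data.Product.Function.NonDependent.Propositional using (_×-↔_)
open import Data.Sum using (_⊎_; inj₁; inj₂)
import Data.Sum as Sum
open import Function.Base using (_∘_)
open import Function.Bundles using (_↔_; module Inverse)
open import Function.Construct.Composition using (_↔-∘_)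
open import Function.Construct.Identity using (↔-id)
open import Function.Construct.Symmetry using (↔-sym)
open import Function.Properties.Inverse using (↔⇒↣)
open import Relation.Binary.Definitions using (DecidableEquality)
open import Relation.Binary.PropositionalEquality
  using (_≡_; _≢_; refl; sym; trans; cong; subst)
open import Relation.Nullary using (¬_; Dec; yes; no; contradiction)
open import Relation.Nullary.Decidable using (map′; via-injection; _×-dec_; _⊎-dec_; recompute)

infixr 5 _∷_

data Walk {V : Set} (_~_ : V → V → Set) : V → V → ℕ → Set where
  []  : ∀ {u} → Walk _~_ u u 0
  _∷_ : ∀ {u v w l} → u ~ v → Walk _~_ v w l → Walk _~_ u w (suc l)

record Graph : Set₁ where
  infix 4 _~_ _~?_
  field
    Vertex    : Set
    order     : ℕ
    finite    : Vertex ↔ Fin order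
    _~_       : Vertex → Vertex → Set
    _~?_      : ∀ u v → Dec (u ~ v)
    ~-sym     : ∀ {u v} → u ~ v → v ~ u
    ~-irrefl  : ∀ {u} → ¬ (u ~ u)
    connected : ∀ u v → ∃[ l ] Walk _~_ u v l

  _≟ⱽ_ : DecidableEquality Vertex
  _≟ⱽ_ = via-injection (↔⇒↣ finite) Fin._≟_

  any-vertex? : {P : Vertex → Set} → (∀ v → Dec (P v)) → Dec (∃ P)
  any-vertex? {P} P? = map′
    (λ (i , p) → from i , p)
    (λ (v , p) → to v , subst P (sym (strictlyInverseʳ v)) p)
    (any? (P? ∘ from))
    where open Inverse finite

  walk? : ∀ u v l → Dec (Walk _~_ u v l)
  walk? u v zero    = map′ (λ { refl → [] }) (λ { [] → refl }) (u ≟ⱽ v)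
  walk? u v (suc l) = map′
    (λ (_ , e , p) → e ∷ p)
    (λ { (e ∷ p) → _ , e , p })
    (any-vertex? (λ w → (u ~? w) ×-dec walk? w v l))

  -- A walk of minimal length repeats no vertex, so minimising over walks is
  -- the same as minimising over paths.
  IsDistance : Vertex → Vertex → ℕ → Set
  IsDistance u v d = Walk _~_ u v d × (∀ l → Walk _~_ u v l → d ≤ l)

least : {P : ℕ → Set} → (∀ l → Dec (P l)) → ∃ P → ∃[ d ] (P d × (∀ l → P l → d ≤ l))
least {P} P? (b , pb) = search (suc b)
    (λ none → contradiction pb (none b ≤-refl))
  where
  search : ∀ b → ((∀ l → l < b → ¬ P l) → ∃[ d ] (P d × (∀ l → P l → d ≤ l))) →
           ∃[ d ] (P d × (∀ l → P l → d ≤ l))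
  search zero    k = k (λ _ ())
  search (suc b) k = search b λ none → case-b none (P? b)
    where
    case-b : (∀ l → l < b → ¬ P l) → Dec (P b) → ∃[ d ] (P d × (∀ l → P l → d ≤ l))
    case-b none (yes p) = b , p , λ l pl → ≮⇒≥ (λ l<b → none l l<b pl)
    case-b none (no ¬p) = k λ l l<1+b pl →
      Sum.[ (λ l<b → none l l<b pl) , (λ { refl → ¬p pl }) ]
        (m≤n⇒m<n∨m≡n (≤-pred l<1+b))

module _ (G : Graph) where
  open Graph G

  distance : ∀ u v → ∃[ d ] IsDistance u v d
  distance u v = least (walk? u v) (connected u v)

  d : Vertex → Vertex → ℕ
  d u v = proj₁ (distance u v)

  r : Vertex → List Vertex → List ℕ
  r x Q = map (d x) Q

  -- An ordered set of vertices is a list without repetitions.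
  IsResolvingSet : List Vertex → Set
  IsResolvingSet Q = Unique Q × (∀ x y → x ≢ y → r x Q ≢ r y Q)

  IsMetricDimension : ℕ → Set
  IsMetricDimension l =
    (∃[ Q ] (IsResolvingSet Q × length Q ≡ l)) ×
    (∀ Q → IsResolvingSet Q → l ≤ length Q)

module _ {V : Set} {_~_ : V → V → Set} where
  infixr 5 _++ʷ_
  _++ʷ_ : ∀ {u v w l l′} → Walk _~_ u v l → Walk _~_ v w l′ → Walk _~_ u w (l + l′)
  []      ++ʷ q = q
  (e ∷ p) ++ʷ q = e ∷ (p ++ʷ q)

  mapʷ : {W : Set} {_≈_ : W → W → Set} (f : V → W) → (∀ {u v} → u ~ v → f u ≈ f v) →
         ∀ {u v l} → Walk _~_ u v l → Walk _≈_ (f u) (f v) l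
  mapʷ f h []      = []
  mapʷ f h (e ∷ p) = h e ∷ mapʷ f h p

module _ {k : ℕ} where
  _~ᴾ_ : Fin k → Fin k → Set
  i ~ᴾ j = ∣ toℕ i - toℕ j ∣ ≡ 1

  ~ᴾ-sym : ∀ {i j} → i ~ᴾ j → j ~ᴾ i
  ~ᴾ-sym {i} {j} e = trans (∣-∣-comm (toℕ j) (toℕ i)) e

  ~ᴾ-irrefl : ∀ {i} → ¬ (i ~ᴾ i)
  ~ᴾ-irrefl {i} e with () ← trans (sym (∣n-n∣≡0 (toℕ i))) e

connectedᴾ : ∀ {k} (i j : Fin k) → ∃[ l ] Walk _~ᴾ_ i j l
connectedᴾ zero          zero          = 0 , []
connectedᴾ {suc (suc k)} zero (suc j)  =
  let l , p = connectedᴾ zero j in suc l , refl ∷ mapʷ suc (λ e → e) p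
connectedᴾ {suc (suc k)} (suc i) zero  =
  let l , p = connectedᴾ i zero in l + 1 , mapʷ suc (λ e → e) p ++ʷ (refl ∷ [])
connectedᴾ (suc i)       (suc j)       =
  let l , p = connectedᴾ i j in l , mapʷ suc (λ e → e) p

P : ℕ → Graph
P k = record
  { Vertex    = Fin k
  ; order     = k
  ; finite    = ↔-id (Fin k)
  ; _~_       = _~ᴾ_
  ; _~?_      = λ i j → ∣ toℕ i - toℕ j ∣ ≟ 1
  ; ~-sym     = λ {i} {j} → ~ᴾ-sym {i = i} {j}
  ; ~-irrefl  = λ {i} → ~ᴾ-irrefl {i = i}
  ; connected = connectedᴾ
  }

-- The path 0, …, n - 1 closed up by the edge between its ends: these are the
-- only two elements of Fin n whose difference is n - 1.
_~ᶜ_ : ∀ {n} → Fin n → Fin n → Set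
_~ᶜ_ {n} i j = ∣ toℕ i - toℕ j ∣ ≡ 1 ⊎ suc ∣ toℕ i - toℕ j ∣ ≡ n

C : (n : ℕ) → .(3 ≤ n) → Graph
C n 3≤n = record
  { Vertex    = Fin n
  ; order     = n
  ; finite    = ↔-id (Fin n)
  ; _~_       = _~ᶜ_
  ; _~?_      = λ i j → (∣ toℕ i - toℕ j ∣ ≟ 1) ⊎-dec (suc ∣ toℕ i - toℕ j ∣ ≟ n)
  ; ~-sym     = λ {i} {j} → Sum.map (trans (∣-∣-comm (toℕ j) (toℕ i)))
                                    (trans (cong suc (∣-∣-comm (toℕ j) (toℕ i))))
  ; ~-irrefl  = λ {i} → irrefl i (recompute (3 ≤? n) 3≤n)
  ; connected = λ i j → let l , p = connectedᴾ i j in l , mapʷ (λ v → v) inj₁ p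
  }
  where
  irrefl : ∀ {n} (i : Fin n) → 3 ≤ n → ¬ (i ~ᶜ i)
  irrefl i _   (inj₁ e) = ~ᴾ-irrefl {i = i} e
  irrefl i 3≤n (inj₂ e) with subst (3 ≤_) (trans (sym e) (cong suc (∣n-n∣≡0 (toℕ i)))) 3≤n
  ... | s≤s ()

infixl 6 _□_

_□_ : Graph → Graph → Graph
G □ H = record
  { Vertex    = G.Vertex × H.Vertex
  ; order     = G.order * H.order
  ; finite    = ↔-sym *↔× ↔-∘ (G.finite ×-↔ H.finite)
  ; _~_       = _~_
  ; _~?_      = λ (g₁ , h₁) (g₂ , h₂) →
                  ((h₁ H.≟ⱽ h₂) ×-dec (g₁ G.~? g₂)) ⊎-dec ((g₁ G.≟ⱽ g₂) ×-dec (h₁ H.~? h₂))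
  ; ~-sym     = Sum.map (λ (e , a) → sym e , G.~-sym a) (λ (e , a) → sym e , H.~-sym a)
  ; ~-irrefl  = Sum.[ (λ (_ , a) → G.~-irrefl a) , (λ (_ , a) → H.~-irrefl a) ]
  ; connected = λ (g₁ , h₁) (g₂ , h₂) →
      let l  , p = G.connected g₁ g₂
          l′ , q = H.connected h₁ h₂
      in l + l′ , mapʷ (_, h₁) (λ a → inj₁ (refl , a)) p ++ʷ
                  mapʷ (g₂ ,_) (λ a → inj₂ (refl , a)) q
  }
  where
  module G = Graph G
  module H = Graph H
  _~_ : G.Vertex × H.Vertex → G.Vertex × H.Vertex → Set
  (g₁ , h₁) ~ (g₂ , h₂) = (h₁ ≡ h₂ × g₁ G.~ g₂) ⊎ (g₁ ≡ g₂ × h₁ H.~ h₂)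

{-# OPTIONS --safe #-}
-- Distances in the product are sums of the three coordinate distances, and the
-- graph is bipartite, so every edge changes every distance by exactly one.
--
-- Three vertices never resolve. If one of them has five neighbours, two of these
-- lie on the same side (closer or farther) with respect to each of the other two. Otherwise all three
-- are at ends of both paths, and each direction of motion along a path changes
-- the three distances by a constant sign vector. Along the cycle, at a vertex v,
-- the distance to t changes by the same sign in both directions exactly when t
-- is v or its antipode, and by opposite signs otherwise. Comparing these sign
-- vectors at the cycle coordinates of at most two of the landmarks produces two
-- vertices with the same distances.
--
-- Four vertices resolve: two landmarks at opposite ends of a path determine the
-- coordinate on this path, and a vertex of an even cycle is determined by its
-- distances to two adjacent vertices.
module Submission where

open import Defs
open import Data.Fin using (Fin; zero; suc; toℕ; fromℕ; fromℕ<; inject₁; splitAt; join; combine; _↑ˡ_)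
open import Data.Fin.Properties as Fin
  using (any?; all?; toℕ<n; toℕ-fromℕ<; toℕ-injective; toℕ-inject₁; toℕ-↑ˡ; pigeonhole;
         combine-injective; join-splitAt)
open import Data.List using (List; []; _∷_; length)
open import Data.List.Properties using (∷-injective)
open import Data.List.Relation.Unary.All using ([]; _∷_)
open import Data.List.Relation.Unary.AllPairs using ([]; _∷_)
open import Data.List.Relation.Unary.Unique.Propositional using (Unique)
open import Data.Nat using (ℕ; zero; suc; _+_; _*_; _∸_; _⊓_; _≤_; _<_; z≤n; s≤s; ∣_-_∣; _≟_)
open import Data.Nat.Divisibility using (_∣_; divides)
open import Data.Nat.Properties hiding (_≟_)
open import Data.Nat.Tactic.RingSolver using (solve-∀)
open import Data.Product using (∃; ∃-syntax; _×_; _,_; proj₁; proj₂)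
open import Data.Product.Properties using (≡-dec)
open import Data.Sum as Sum using (_⊎_; inj₁; inj₂)
open import Function.Base using (_∘_)
open import Function.Definitions using (Injective)
open import Relation.Binary.Definitions using (tri<; tri≈; tri>)
open import Relation.Binary.PropositionalEquality
open import Relation.Nullary using (¬_; Dec; contradiction)
open import Relation.Nullary.Decidable using (map′; _×-dec_; _⊎-dec_; ¬?; from-yes)

-- Local sign patterns at three corner landmarks, checked exhaustively.

Bit : Set
Bit = Fin 2

opp : Bit → Bit
opp zero = suc zero
opp (suc zero) = zero

_⊕_ : Bit → Bit → Bit
zero     ⊕ b = b
suc zero ⊕ b = opp b

-- Along the cycle, the distance to a landmark has a local extremum (`turn`) or is monotone
-- (`pass`).
data Shape : Set where
  turn pass : Shape

Landmark : Set
Landmark = Bit × Bit × Bit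

Point : Set
Point = Fin 3 × Bit × Bit

bit : Bit → ℕ
bit zero = 0
bit (suc zero) = 1

hop : Bit → ℕ
hop zero = 0
hop (suc zero) = 2

-- The points of Fin 3 stand for a cycle vertex, its successor and its
-- predecessor. Levels are relative to the first and shifted by one, to stay in ℕ;
-- σ tells whether the successor is farther away.
level : Shape → Bit → Fin 3 → ℕ
level _    σ zero             = 1
level _    σ (suc zero)       = hop σ
level turn σ (suc (suc zero)) = hop σ
level pass σ (suc (suc zero)) = hop (opp σ)

-- The bit β (resp. γ) says at which end of the first (resp. second) path the
-- landmark lies.
height : Shape → Landmark → Point → ℕ
height s (σ , β , γ) (p , b , c) = level s σ p + bit (β ⊕ b) + bit (γ ⊕ c)

Clash : (s₁ s₂ s₃ : Shape) (l₁ l₂ l₃ : Landmark) → Set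
Clash s₁ s₂ s₃ l₁ l₂ l₃ = ∃[ x ] ∃[ y ] (x ≢ y × height s₁ l₁ x ≡ height s₁ l₁ y
                    × height s₂ l₂ x ≡ height s₂ l₂ y × height s₃ l₃ x ≡ height s₃ l₃ y)

any-point? : {P : Point → Set} → (∀ x → Dec (P x)) → Dec (∃ P)
any-point? P? = map′ (λ (p , b , c , q) → (p , b , c) , q) (λ ((p , b , c) , q) → p , b , c , q)
  (any? λ p → any? λ b → any? λ c → P? (p , b , c))

all-landmarks? : {P : Landmark → Set} → (∀ x → Dec (P x)) → Dec (∀ x → P x)
all-landmarks? P? = map′ (λ f (p , b , c) → f p b c) (λ f p b c → f (p , b , c))
  (all? λ p → all? λ b → all? λ c → P? (p , b , c))

_≟ᵖ_ : (x y : Point) → Dec (x ≡ y)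
_≟ᵖ_ = ≡-dec Fin._≟_ (≡-dec Fin._≟_ Fin._≟_)

clash? : ∀ s₁ s₂ s₃ l₁ l₂ l₃ → Dec (Clash s₁ s₂ s₃ l₁ l₂ l₃)
clash? s₁ s₂ s₃ l₁ l₂ l₃ = any-point? λ x → any-point? λ y → (¬? (x ≟ᵖ y)) ×-dec
  (height s₁ l₁ x ≟ height s₁ l₁ y) ×-dec (height s₂ l₂ x ≟ height s₂ l₂ y) ×-dec
  (height s₃ l₃ x ≟ height s₃ l₃ y)

skew : Landmark → Bit
skew (_ , β , γ) = β ⊕ γ

-- The two cycle directions change every one of the three distances alike.
turn-turn-turn : ∀ l₁ l₂ l₃ → Clash turn turn turn l₁ l₂ l₃
turn-turn-turn _ _ _ =
  (suc zero , zero , zero) , (suc (suc zero) , zero , zero) , (λ ()) , refl , refl , refl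

abstract
  -- The sign vectors of successor and predecessor differ only at the passing landmark. If a path
  -- vector agrees up to sign with one of them or with the other path vector, two moves coincide or
  -- cancel. Otherwise the path vectors, up to sign, also differ only at that landmark, so their sum
  -- or difference makes up for exchanging successor and predecessor.
  turn-turn-pass : ∀ l₁ l₂ l₃ → Clash turn turn pass l₁ l₂ l₃
  turn-turn-pass = from-yes (all-landmarks? λ l₁ → all-landmarks? λ l₂ → all-landmarks? λ l₃ →
    clash? turn turn pass l₁ l₂ l₃)

  -- The directions of the two paths change the three distances by sign vectors
  -- whose entrywise product is recorded by skew. Up to a global sign, the cycle
  -- directions at the turning landmark take two of the four sign vectors;
  -- without a clash the path directions take the other two.
  turn-pass-pass : ∀ l₁ l₂ l₃ →
    Clash turn pass pass l₁ l₂ l₃ ⊎ (skew l₁ ≢ skew l₂ × skew l₂ ≡ skew l₃)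
  turn-pass-pass = from-yes (all-landmarks? λ l₁ → all-landmarks? λ l₂ → all-landmarks? λ l₃ →
    clash? turn pass pass l₁ l₂ l₃
      ⊎-dec (¬? (skew l₁ Fin.≟ skew l₂) ×-dec (skew l₂ Fin.≟ skew l₃)))

-- Unit steps and walks.

Step : ℕ → ℕ → Set
Step x y = y ≡ suc x ⊎ x ≡ suc y

Step-sym : ∀ {x y} → Step x y → Step y x
Step-sym = Sum.swap

Step-+ʳ : ∀ z {x y} → Step x y → Step (x + z) (y + z)
Step-+ʳ z = Sum.map (cong (_+ z)) (cong (_+ z))

Step-+ˡ : ∀ z {x y} → Step x y → Step (z + x) (z + y)
Step-+ˡ z {x} {y} = Sum.map
  (λ e → trans (cong (z +_) e) (+-suc z x))
  (λ e → trans (cong (z +_) e) (+-suc z y))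

Step⇒≤ : ∀ {x y} → Step x y → x ≤ suc y
Step⇒≤ (inj₁ refl) = m≤n⇒m≤1+n (n≤1+n _)
Step⇒≤ (inj₂ refl) = ≤-refl

∣-∣≡1⇒Step : ∀ x y → ∣ x - y ∣ ≡ 1 → Step x y
∣-∣≡1⇒Step zero    y       e = inj₁ e
∣-∣≡1⇒Step (suc x) zero    e = inj₂ e
∣-∣≡1⇒Step (suc x) (suc y) e = Sum.map (cong suc) (cong suc) (∣-∣≡1⇒Step x y e)

∣n-1+n∣≡1 : ∀ n → ∣ n - suc n ∣ ≡ 1
∣n-1+n∣≡1 zero    = refl
∣n-1+n∣≡1 (suc n) = ∣n-1+n∣≡1 n

Step-∣-∣-suc : ∀ x t → Step ∣ x - t ∣ ∣ suc x - t ∣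
Step-∣-∣-suc x       zero    = inj₁ (cong suc (sym (∣-∣-identityʳ x)))
Step-∣-∣-suc zero    (suc t) = inj₂ refl
Step-∣-∣-suc (suc x) (suc t) = Step-∣-∣-suc x t

Step-∣-∣ : ∀ {x y} t → Step x y → Step ∣ x - t ∣ ∣ y - t ∣
Step-∣-∣ t (inj₁ refl) = Step-∣-∣-suc _ t
Step-∣-∣ t (inj₂ refl) = Step-sym (Step-∣-∣-suc _ t)

module _ {V : Set} {_~_ : V → V → Set} where

  -- Gives the lower bounds for distances: take `f` to be the conjectured distance to `v`.
  lipschitz-walk : (f : V → ℕ) → (∀ {u w} → u ~ w → f u ≤ suc (f w)) →
                   ∀ {u v l} → Walk _~_ u v l → f u ≤ l + f v
  lipschitz-walk f lip []      = ≤-refl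
  lipschitz-walk f lip (e ∷ p) = ≤-trans (lip e) (s≤s (lipschitz-walk f lip p))

  reverseʷ : (∀ {u w} → u ~ w → w ~ u) → ∀ {u v l} → Walk _~_ u v l → Walk _~_ v u l
  reverseʷ ~-sym []                   = []
  reverseʷ ~-sym {l = suc l} (e ∷ p) =
    subst (Walk _~_ _ _) (+-comm l 1) (reverseʷ ~-sym p ++ʷ (~-sym e ∷ []))

-- Bipartite distances and vertices of high degree.

module _ (G : Graph) where
  open Graph G

  d-unique : ∀ {u v x} → IsDistance u v x → d G u v ≡ x
  d-unique {u} {v} (p , p-least) with y , q , q-least ← distance G u v =
    ≤-antisym (q-least _ p) (p-least _ q)

  d-refl : ∀ v → d G v v ≡ 0
  d-refl v = d-unique ([] , λ _ _ → z≤n)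

  -- For a connected graph this says that it is bipartite.
  Alternating : Set
  Alternating = ∀ {u w} t → u ~ w → Step (d G u t) (d G w t)

  Star : Vertex → ℕ → Set
  Star v j = ∃[ nb ] (Injective {A = Fin j} _≡_ _≡_ nb × (∀ i → v ~ nb i))

  record Unresolved (q₁ q₂ q₃ : Vertex) : Set where
    constructor unresolved-pair
    field
      x y  : Vertex
      x≢y  : x ≢ y
      eq₁  : d G x q₁ ≡ d G y q₁
      eq₂  : d G x q₂ ≡ d G y q₂
      eq₃  : d G x q₃ ≡ d G y q₃

  swap₁₂ : ∀ {q₁ q₂ q₃} → Unresolved q₁ q₂ q₃ → Unresolved q₂ q₁ q₃
  swap₁₂ (unresolved-pair x y x≢y e₁ e₂ e₃) = unresolved-pair x y x≢y e₂ e₁ e₃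

  swap₂₃ : ∀ {q₁ q₂ q₃} → Unresolved q₁ q₂ q₃ → Unresolved q₁ q₃ q₂
  swap₂₃ (unresolved-pair x y x≢y e₁ e₂ e₃) = unresolved-pair x y x≢y e₁ e₃ e₂

  side : ∀ {x y} → Step x y → Fin 2
  side (inj₁ _) = zero
  side (inj₂ _) = suc zero

  side-injective : ∀ {x y z} (p : Step x y) (q : Step x z) → side p ≡ side q → y ≡ z
  side-injective (inj₁ p) (inj₁ q) _ = trans p (sym q)
  side-injective (inj₂ p) (inj₂ q) _ = suc-injective (trans (sym p) q)

  -- The neighbours of q₁ have only 2 · 2 possible distance vectors.
  crowded : Alternating → ∀ {q₁} → Star q₁ 5 → ∀ q₂ q₃ → Unresolved q₁ q₂ q₃
  crowded alt {q₁} (nb , nb-injective , adj) q₂ q₃ =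
    let i , j , i<j , e = pigeonhole {4} ≤-refl λ i → combine (side (to₂ i)) (side (to₃ i))
        e₂ , e₃ = combine-injective (side (to₂ i)) (side (to₃ i)) (side (to₂ j)) (side (to₃ j)) e
    in unresolved-pair (nb i) (nb j) (λ eq → <⇒≢ i<j (cong toℕ (nb-injective eq)))
         (trans (one i) (sym (one j)))
         (side-injective (to₂ i) (to₂ j) e₂) (side-injective (to₃ i) (to₃ j) e₃)
    where
    to₂ : ∀ i → Step (d G q₁ q₂) (d G (nb i) q₂)
    to₂ i = alt q₂ (adj i)

    to₃ : ∀ i → Step (d G q₁ q₃) (d G (nb i) q₃)
    to₃ i = alt q₃ (adj i)

    one : ∀ i → d G (nb i) q₁ ≡ 1
    one i with alt q₁ (adj i)
    ... | inj₁ e = trans e (cong suc (d-refl q₁))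
    ... | inj₂ e with () ← trans (sym (d-refl q₁)) e

-- Distances and degrees in a product.

module _ {G H : Graph} where
  private
    module G = Graph G
    module H = Graph H

  -- Each edge of the product moves exactly one factor, so the two projections share out the length.
  unzip-walk : ∀ {g h g′ h′ l} → Walk (Graph._~_ (G □ H)) (g , h) (g′ , h′) l →
               ∃[ i ] ∃[ j ] (Walk G._~_ g g′ i × Walk H._~_ h h′ j × i + j ≡ l)
  unzip-walk []                     = 0 , 0 , [] , [] , refl
  unzip-walk (inj₁ (refl , e) ∷ p) =
    let i , j , p₁ , p₂ , eq = unzip-walk p in suc i , j , e ∷ p₁ , p₂ , cong suc eq
  unzip-walk (inj₂ (refl , e) ∷ p) =
    let i , j , p₁ , p₂ , eq = unzip-walk p in i , suc j , p₁ , e ∷ p₂ , trans (+-suc i j) (cong suc eq)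

  d-□ : ∀ g h g′ h′ → d (G □ H) (g , h) (g′ , h′) ≡ d G g g′ + d H h h′
  d-□ g h g′ h′ with x , p , p-least ← distance G g g′ | y , q , q-least ← distance H h h′ =
    d-unique (G □ H)
      ( mapʷ (_, h) (λ a → inj₁ (refl , a)) p ++ʷ mapʷ (g′ ,_) (λ a → inj₂ (refl , a)) q
      , λ l w → let i , j , w₁ , w₂ , eq = unzip-walk w
                in subst (_ ≤_) eq (+-mono-≤ (p-least i w₁) (q-least j w₂)))

  alternating-□ : Alternating G → Alternating H → Alternating (G □ H)
  alternating-□ altG altH {g , h} {g′ , h′} (t , s) e =
    subst₂ Step (sym (d-□ g h t s)) (sym (d-□ g′ h′ t s)) (go e)
    where
    go : Graph._~_ (G □ H) (g , h) (g′ , h′) → Step (d G g t + d H h s) (d G g′ t + d H h′ s)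
    go (inj₁ (refl , a)) = Step-+ʳ (d H h s) (altG t a)
    go (inj₂ (refl , a)) = Step-+ˡ (d G g t) (altH s a)

  -- Degrees add: a neighbour along `G` equal to one along `H` would give a loop in `G`.
  star-□ : ∀ {g h i j} → Star G g i → Star H h j → Star (G □ H) (g , h) (i + j)
  star-□ {g} {h} {i} {j} (nb₁ , nb₁-injective , adj₁) (nb₂ , nb₂-injective , adj₂) =
    nb ∘ splitAt i ,
    (λ {x} {y} e → trans (sym (join-splitAt i j x))
      (trans (cong (join i j) (nb-injective (splitAt i x) (splitAt i y) e)) (join-splitAt i j y))) ,
    adj ∘ splitAt i
    where
    nb : Fin i ⊎ Fin j → Graph.Vertex (G □ H)
    nb (inj₁ a) = nb₁ a , h
    nb (inj₂ b) = g , nb₂ b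

    nb-injective : ∀ x y → nb x ≡ nb y → x ≡ y
    nb-injective (inj₁ a) (inj₁ b) e = cong inj₁ (nb₁-injective (cong proj₁ e))
    nb-injective (inj₁ a) (inj₂ b) e = contradiction (subst (g G.~_) (cong proj₁ e) (adj₁ a)) G.~-irrefl
    nb-injective (inj₂ a) (inj₁ b) e = contradiction (subst (g G.~_) (sym (cong proj₁ e)) (adj₁ b)) G.~-irrefl
    nb-injective (inj₂ a) (inj₂ b) e = cong inj₂ (nb₂-injective (cong proj₂ e))

    adj : ∀ x → Graph._~_ (G □ H) (g , h) (nb x)
    adj (inj₁ a) = inj₁ (refl , adj₁ a)
    adj (inj₂ b) = inj₂ (refl , adj₂ b)

module _ {G : Graph} where
  open Graph G

  single : ∀ {v x} → v ~ x → Star G v 1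
  single {v} {x} e = (λ _ → x) , (λ { {zero} {zero} _ → refl }) , λ _ → e

  pair : ∀ {v x y} → x ≢ y → v ~ x → v ~ y → Star G v 2
  pair {v} {x} {y} x≢y e f = nb , nb-injective , (λ { zero → e ; (suc zero) → f })
    where
    nb : Fin 2 → Vertex
    nb zero       = x
    nb (suc zero) = y

    nb-injective : Injective _≡_ _≡_ nb
    nb-injective {zero}     {zero}     _ = refl
    nb-injective {zero}     {suc zero} e = contradiction e x≢y
    nb-injective {suc zero} {zero}     e = contradiction (sym e) x≢y
    nb-injective {suc zero} {suc zero} _ = refl

-- Paths: distances, inner vertices and ends.

lineᴾ : ∀ {k} (i j : Fin k) → Walk _~ᴾ_ i j ∣ toℕ i - toℕ j ∣
lineᴾ zero                  zero    = []
lineᴾ {suc (suc k)} zero    (suc j) = refl ∷ mapʷ suc (λ e → e) (lineᴾ zero j)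
lineᴾ {suc (suc k)} (suc i) zero    =
  subst (Walk _~ᴾ_ _ _) (trans (+-comm _ 1) (cong suc (∣-∣-identityʳ (toℕ i))))
    (mapʷ suc (λ e → e) (lineᴾ i zero) ++ʷ (refl ∷ []))
lineᴾ (suc i)               (suc j) = mapʷ suc (λ e → e) (lineᴾ i j)

stepᴾ : ∀ {k} {i j : Fin k} t → i ~ᴾ j → Step ∣ toℕ i - t ∣ ∣ toℕ j - t ∣
stepᴾ {i = i} {j} t e = Step-∣-∣ t (∣-∣≡1⇒Step (toℕ i) (toℕ j) e)

d-P : ∀ {k} (i j : Fin k) → d (P k) i j ≡ ∣ toℕ i - toℕ j ∣
d-P {k} i j = d-unique (P k) (lineᴾ i j , λ l p → begin
  ∣ toℕ i - toℕ j ∣     ≤⟨ lipschitz-walk (λ x → ∣ toℕ x - toℕ j ∣)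
                             (λ {u} {w} e → Step⇒≤ (stepᴾ {i = u} {w} (toℕ j) e)) p ⟩
  l + ∣ toℕ j - toℕ j ∣ ≡⟨ cong (l +_) (∣n-n∣≡0 (toℕ j)) ⟩
  l + 0                 ≡⟨ +-identityʳ l ⟩
  l                     ∎)
  where open ≤-Reasoning

alternatingᴾ : ∀ k → Alternating (P k)
alternatingᴾ k {u} {w} t e = subst₂ Step (sym (d-P u t)) (sym (d-P w t)) (stepᴾ {i = u} {w} (toℕ t) e)

End : ∀ {k} → Fin k → Set
End {k} x = toℕ x ≡ 0 ⊎ suc (toℕ x) ≡ k

below : ∀ {k} (i : Fin k) → suc i ~ᴾ inject₁ i
below i = trans (∣-∣-comm (suc (toℕ i)) (toℕ (inject₁ i)))
          (subst (λ x → ∣ x - suc (toℕ i) ∣ ≡ 1) (sym (toℕ-inject₁ i)) (∣n-1+n∣≡1 (toℕ i)))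

star₁ᴾ : ∀ {k} (x : Fin (2 + k)) → Star (P (2 + k)) x 1
star₁ᴾ {k} zero    = single {P (2 + k)} {zero} {suc zero} refl
star₁ᴾ {k} (suc i) = single {P (2 + k)} {suc i} {inject₁ i} (below i)

end-or-star₂ᴾ : ∀ {k} (x : Fin k) → End x ⊎ Star (P k) x 2
end-or-star₂ᴾ zero = inj₁ (inj₁ refl)
end-or-star₂ᴾ {suc k} x@(suc i) with m≤n⇒m<n∨m≡n (toℕ<n x)
... | inj₂ e = inj₁ (inj₂ e)
... | inj₁ x+1<k = inj₂ (pair {P (suc k)} {x} {inject₁ i} {fromℕ< x+1<k} apart (below i) above)
  where
  apart : inject₁ i ≢ fromℕ< x+1<k
  apart e = <⇒≢ (n≤1+n _) (trans (sym (toℕ-inject₁ i)) (trans (cong toℕ e) (toℕ-fromℕ< x+1<k)))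
  above : x ~ᴾ fromℕ< x+1<k
  above = subst (λ y → ∣ toℕ x - y ∣ ≡ 1) (sym (toℕ-fromℕ< x+1<k)) (∣n-1+n∣≡1 (toℕ x))

-- `b` selects one of the two lowest path vertices. Moving from 0 to 1 leads away from the end 0 and
-- towards the far end; `B` is the smaller of the two distances.
end-profile : ∀ {k} {x : Fin (2 + k)} → End x →
              ∃[ B ] ∃[ β ] (∀ b → ∣ toℕ (b ↑ˡ k) - toℕ x ∣ ≡ B + bit (β ⊕ b))
end-profile {k} {x} (inj₁ e) = 0 , zero , λ b → trans (cong₂ ∣_-_∣ (toℕ-↑ˡ b k) e) (check b)
  where
  check : ∀ b → ∣ toℕ b - 0 ∣ ≡ bit b
  check zero       = refl
  check (suc zero) = refl
end-profile {k} {x} (inj₂ e) = k , suc zero , λ b → trans (cong₂ ∣_-_∣ (toℕ-↑ˡ b k) (suc-injective e)) (check b)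
  where
  check : ∀ b → ∣ toℕ b - suc k ∣ ≡ k + bit (opp b)
  check zero       = +-comm 1 k
  check (suc zero) = sym (+-identityʳ k)

-- The even cycle and its cyclic order.

module EvenCycle (h : ℕ) (2≤h : 2 ≤ h) where

  n : ℕ
  n = h + h

  h<n : h < n
  h<n = subst (_≤ n) (+-comm h 1) (+-monoʳ-≤ h (≤-trans (n≤1+n 1) 2≤h))

  4≤n : 4 ≤ n
  4≤n = +-mono-≤ 2≤h 2≤h

  0<n : 0 < n
  0<n = ≤-trans (s≤s z≤n) 4≤n

  cycle : Graph
  cycle = C n (≤-trans (n≤1+n 3) 4≤n)

  open Graph cycle using (_~_; ~-sym; ~-irrefl)

  -- The cyclic order, put on numbers so that it serves both vertices and offsets between them.
  Next : ℕ → ℕ → Set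
  Next u w = suc u ≡ w ⊎ (suc u ≡ n × w ≡ 0)

  extremes : ∀ {i j} → suc ∣ i - j ∣ ≡ n → j < n → i ≤ j → suc j ≡ n × i ≡ 0
  extremes {zero}          e _   _         = e , refl
  extremes {suc i} {suc j} e j<n (s≤s i≤j) = contradiction
    (subst (_≤ suc j) e (s≤s (subst (_≤ j) (sym (m≤n⇒∣m-n∣≡n∸m i≤j)) (m∸n≤m j i)))) (<⇒≱ j<n)

  adj⇒Next : (i j : Fin n) → i ~ j → Next (toℕ i) (toℕ j) ⊎ Next (toℕ j) (toℕ i)
  adj⇒Next i j (inj₁ e) = Sum.map (inj₁ ∘ sym) (inj₁ ∘ sym) (∣-∣≡1⇒Step (toℕ i) (toℕ j) e)
  adj⇒Next i j (inj₂ e) with ≤-total (toℕ i) (toℕ j)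
  ... | inj₁ i≤j = inj₂ (inj₂ (extremes e (toℕ<n j) i≤j))
  ... | inj₂ j≤i = inj₁ (inj₂ (extremes (trans (cong suc (∣-∣-comm (toℕ j) (toℕ i))) e) (toℕ<n i) j≤i))

  Next⇒adj : (i j : Fin n) → Next (toℕ i) (toℕ j) → i ~ j
  Next⇒adj i j (inj₁ e)        = inj₁ (subst (λ x → ∣ toℕ i - x ∣ ≡ 1) e (∣n-1+n∣≡1 (toℕ i)))
  Next⇒adj i j (inj₂ (e , e₀)) =
    inj₂ (trans (cong suc (trans (cong ∣ toℕ i -_∣ e₀) (∣-∣-identityʳ (toℕ i)))) e)

  successor : (v : Fin n) → ∃[ w ] Next (toℕ v) (toℕ w)
  successor v with m≤n⇒m<n∨m≡n (toℕ<n v)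
  ... | inj₁ lt = fromℕ< lt , inj₁ (sym (toℕ-fromℕ< lt))
  ... | inj₂ e  = fromℕ< 0<n , inj₂ (e , toℕ-fromℕ< 0<n)

  last : ∃[ w ] suc (toℕ {n} w) ≡ n
  last = fromℕ< (≤-reflexive 1+[n∸1]≡n) , trans (cong suc (toℕ-fromℕ< (≤-reflexive 1+[n∸1]≡n))) 1+[n∸1]≡n
    where
    1+[n∸1]≡n : suc (n ∸ 1) ≡ n
    1+[n∸1]≡n = m+[n∸m]≡n 0<n

  predecessor : (v : Fin n) → ∃[ u ] Next (toℕ u) (toℕ v)
  predecessor v with toℕ v in eq
  ... | zero  = proj₁ last , inj₂ (proj₂ last , refl)
  ... | suc x = fromℕ< x<n , inj₁ (cong suc (toℕ-fromℕ< x<n))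
    where
    x<n : x < n
    x<n = <-trans (subst (x <_) (sym eq) ≤-refl) (toℕ<n v)

  -- Two steps forward return only on a cycle with at most two vertices. This keeps successor and
  -- predecessor apart.
  Next-no-2-cycle : ∀ {u w} → Next u w → ¬ Next w u
  Next-no-2-cycle (inj₁ refl)       (inj₁ e)          = <⇒≢ (n≤1+n _) (sym e)
  Next-no-2-cycle (inj₁ refl)       (inj₂ (e , refl)) = <⇒≢ (<-≤-trans (s≤s (s≤s (s≤s z≤n))) 4≤n) e
  Next-no-2-cycle (inj₂ (e , refl)) (inj₁ refl)       = <⇒≢ (<-≤-trans (s≤s (s≤s (s≤s z≤n))) 4≤n) e
  Next-no-2-cycle (inj₂ (e , refl)) (inj₂ (_ , refl)) = <⇒≢ (<-≤-trans (s≤s (s≤s z≤n)) 4≤n) e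

  -- Distance on the cycle as the length of the shorter arc.

  arc : ℕ → ℕ
  arc s = s ⊓ (n ∸ s)

  arc-near : ∀ {s} → s ≤ h → arc s ≡ s
  arc-near {s} s≤h = m≤n⇒m⊓n≡m (m+n≤o⇒m≤o∸n s (+-mono-≤ s≤h s≤h))

  arc-far : ∀ {s} → h ≤ s → arc s ≡ n ∸ s
  arc-far {s} h≤s = m≥n⇒m⊓n≡n (m≤n+o⇒m∸n≤o n s (+-mono-≤ h≤s h≤s))

  arc-reflect : ∀ {s} → s ≤ n → arc (n ∸ s) ≡ arc s
  arc-reflect {s} s≤n = trans (cong ((n ∸ s) ⊓_) (m∸[m∸n]≡n s≤n)) (⊓-comm (n ∸ s) s)

  -- Modulo `n`, `s` steps forward lead from `t` to `a`; stated additively to avoid truncated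
  -- subtraction.
  data Offset (t a s : ℕ) : Set where
    direct  : t + s ≡ a     → Offset t a s
    wrapped : t + s ≡ a + n → Offset t a s

  -- In the wrapped case the numbers differ by the length of the complementary arc.
  Offset-arc : ∀ {t a s} → s < n → Offset t a s → arc ∣ a - t ∣ ≡ arc s
  Offset-arc {t} {s = s} _ (direct refl) =
    cong arc (trans (∣-∣-comm (t + s) t) (∣m-m+n∣≡n t s))
  Offset-arc {t} {a} {s} s<n (wrapped e) = trans (cong arc gap) (arc-reflect (<⇒≤ s<n))
    where
    t≡ : t ≡ a + (n ∸ s)
    t≡ = trans (sym (m+n∸n≡m t s)) (trans (cong (_∸ s) e) (+-∸-assoc a (<⇒≤ s<n)))
    gap : ∣ a - t ∣ ≡ n ∸ s
    gap = trans (cong ∣ a -_∣ t≡) (∣m-m+n∣≡n a (n ∸ s))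

  offset : ∀ {t a} → t < n → a < n → ∃[ s ] (s < n × Offset t a s)
  offset {t} {a} t<n a<n with ≤-<-connex t a
  ... | inj₁ t≤a = a ∸ t , ≤-<-trans (m∸n≤m a t) a<n , direct (m+[n∸m]≡n t≤a)
  ... | inj₂ a<t = (a + n) ∸ t ,
      subst ((a + n) ∸ t <_) (m+n∸m≡n t n) (∸-monoˡ-< (+-monoˡ-< n a<t) t≤a+n) ,
      wrapped (m+[n∸m]≡n t≤a+n)
    where
    t≤a+n : t ≤ a + n
    t≤a+n = ≤-trans (<⇒≤ t<n) (m≤n+m n a)

  -- Rotating `t` to 0 preserves the cyclic order, so a change of distance to `t` becomes a change
  -- of `arc` at a single number.
  Next-offset : ∀ {t u w s} → t < n → w < n → s < n → Next u w → Offset t u s →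
                ∃[ s′ ] (s′ < n × Next s s′ × Offset t w s′)
  Next-offset {t} {s = s} _ w<n _ (inj₁ refl) (direct refl) =
    suc s , ≤-<-trans (s≤s (m≤n+m s t)) w<n , inj₁ refl , direct (+-suc t s)
  Next-offset {t} {u} {w} {s} t<n _ s<n e (wrapped o) with m≤n⇒m<n∨m≡n s<n | e
  ... | inj₁ lt | inj₁ refl = suc s , lt , inj₁ refl , wrapped (trans (+-suc t s) (cong suc o))
  -- One step past the offset `n - 1` the vertex is `t` itself.
  ... | inj₂ eq | inj₁ refl = 0 , 0<n , inj₂ (eq , refl) , direct (trans (+-identityʳ t)
        (+-cancelʳ-≡ s t (suc u) (trans o (trans (cong (u +_) (sym eq)) (+-suc u s)))))
  -- Here `u` is the last vertex, so `t` is at most `u` and the offset cannot wrap.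
  ... | _       | inj₂ (eq , _) = contradiction o
        (<⇒≢ (+-mono-≤-< (≤-pred (subst (t <_) (sym eq) t<n)) s<n))
  Next-offset {t} {s = s} _ _ s<n (inj₂ (e , refl)) (direct refl) with m≤n⇒m<n∨m≡n s<n
  ... | inj₁ lt = suc s , lt , inj₁ refl , wrapped (trans (+-suc t s) e)
  ... | inj₂ eq = 0 , 0<n , inj₂ (eq , refl) ,
        direct (trans (+-identityʳ t) (+-cancelʳ-≡ s t 0 (suc-injective (trans e (sym eq)))))

  -- Evenness enters here: `arc` peaks at the single offset `h`, so no step leaves it unchanged.
  arc-step : ∀ {s s′} → s < n → Next s s′ →
             (s < h × arc s′ ≡ suc (arc s)) ⊎ (h ≤ s × arc s ≡ suc (arc s′))
  arc-step {s} s<n e with <-≤-connex s h | e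
  ... | inj₁ s<h | inj₁ refl = inj₁ (s<h , trans (arc-near s<h) (cong suc (sym (arc-near (<⇒≤ s<h)))))
  ... | inj₁ s<h | inj₂ (eq , _) = contradiction eq (<⇒≢ (≤-<-trans s<h h<n))
  ... | inj₂ h≤s | inj₁ refl = inj₂ (h≤s , trans (arc-far h≤s)
        (trans (+-∸-assoc 1 s<n) (cong suc (sym (arc-far (m≤n⇒m≤1+n h≤s))))))
  ... | inj₂ h≤s | inj₂ (eq , refl) = inj₂ (h≤s , trans (arc-far h≤s) (trans (cong (_∸ s) (sym eq)) (m+n∸n≡m 1 s)))

  D : Fin n → Fin n → ℕ
  D a t = arc ∣ toℕ a - toℕ t ∣

  D-sym : ∀ a t → D a t ≡ D t a
  D-sym a t = cong arc (∣-∣-comm (toℕ a) (toℕ t))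

  D-refl : ∀ t → D t t ≡ 0
  D-refl t = cong arc (∣n-n∣≡0 (toℕ t))

  stepᶜ : ∀ {u w} t → u ~ w → Step (D u t) (D w t)
  stepᶜ {u} {w} t e = Sum.[ forward , Step-sym ∘ forward ] (adj⇒Next u w e)
    where
    forward : ∀ {u w} → Next (toℕ u) (toℕ w) → Step (D u t) (D w t)
    forward {u} {w} e =
      let s , s<n , o = offset (toℕ<n t) (toℕ<n u)
          s′ , s′<n , e′ , o′ = Next-offset (toℕ<n t) (toℕ<n w) s<n e o
      in subst₂ Step (sym (Offset-arc s<n o)) (sym (Offset-arc s′<n o′)) (Sum.map proj₂ proj₂ (arc-step s<n e′))

  short-way : (u v : Fin n) → Walk _~_ u v ∣ toℕ u - toℕ v ∣
  short-way u v = mapʷ (λ x → x) inj₁ (lineᴾ u v)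

  -- Down from `u` to 0, across the closing edge, then down from the last vertex to `v`.
  long-way-≤ : (u v : Fin n) → toℕ u ≤ toℕ v → Walk _~_ u v (n ∸ ∣ toℕ u - toℕ v ∣)
  long-way-≤ u v u≤v = subst (Walk _~_ u v) len
    (short-way u first ++ʷ (first~top ∷ short-way top v))
    where
    first top : Fin n
    first = fromℕ< 0<n
    top = proj₁ last
    top≡ : suc (toℕ top) ≡ n
    top≡ = proj₂ last
    first~top : first ~ top
    first~top = ~-sym {top} {first} (Next⇒adj top first (inj₂ (top≡ , toℕ-fromℕ< 0<n)))
    len : ∣ toℕ u - toℕ first ∣ + suc ∣ toℕ top - toℕ v ∣ ≡ n ∸ ∣ toℕ u - toℕ v ∣
    -- `e` is the gap from `u` to `v` and `f` the gap from `v` to the last vertex, so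
    -- `u + e + f + 1` is `n`.
    len with e , u+e≡v ← m≤n⇒∃[o]m+o≡n u≤v
           | f , v+f≡t ← m≤n⇒∃[o]m+o≡n (≤-pred (subst (toℕ v <_) (sym top≡) (toℕ<n v))) = begin
      ∣ toℕ u - toℕ first ∣ + suc ∣ toℕ top - toℕ v ∣
        ≡⟨ cong₂ (λ x y → x + suc y) (trans (cong ∣ toℕ u -_∣ (toℕ-fromℕ< 0<n)) (∣-∣-identityʳ (toℕ u)))
             (trans (∣-∣-comm (toℕ top) (toℕ v)) (trans (cong ∣ toℕ v -_∣ (sym v+f≡t)) (∣m-m+n∣≡n (toℕ v) f))) ⟩
      toℕ u + suc f                   ≡⟨ m+n∸n≡m (toℕ u + suc f) e ⟨
      toℕ u + suc f + e ∸ e           ≡⟨ cong (_∸ e) (shuffle (toℕ u) f e) ⟩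
      suc (toℕ u + e + f) ∸ e         ≡⟨ cong (λ x → suc (x + f) ∸ e) u+e≡v ⟩
      suc (toℕ v + f) ∸ e             ≡⟨ cong (λ x → suc x ∸ e) v+f≡t ⟩
      suc (toℕ top) ∸ e               ≡⟨ cong₂ _∸_ top≡
        (sym (trans (cong ∣ toℕ u -_∣ (sym u+e≡v)) (∣m-m+n∣≡n (toℕ u) e))) ⟩
      n ∸ ∣ toℕ u - toℕ v ∣           ∎
      where
      open ≡-Reasoning
      shuffle : ∀ u f e → u + suc f + e ≡ suc (u + e + f)
      shuffle = solve-∀

  long-way : (u v : Fin n) → Walk _~_ u v (n ∸ ∣ toℕ u - toℕ v ∣)
  long-way u v with ≤-total (toℕ u) (toℕ v)
  ... | inj₁ u≤v = long-way-≤ u v u≤v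
  ... | inj₂ v≤u = subst (λ x → Walk _~_ u v (n ∸ x)) (∣-∣-comm (toℕ v) (toℕ u))
        (reverseʷ (λ {x} {y} → ~-sym {x} {y}) (long-way-≤ v u v≤u))

  d-C : ∀ u v → d cycle u v ≡ D u v
  d-C u v = d-unique cycle (walk , λ l p → begin
      D u v     ≤⟨ lipschitz-walk (λ x → D x v) (λ {x} {y} e → Step⇒≤ (stepᶜ {x} {y} v e)) p ⟩
      l + D v v ≡⟨ cong (l +_) (D-refl v) ⟩
      l + 0     ≡⟨ +-identityʳ l ⟩
      l         ∎)
    where
    open ≤-Reasoning
    walk : Walk _~_ u v (D u v)
    walk with ⊓-sel ∣ toℕ u - toℕ v ∣ (n ∸ ∣ toℕ u - toℕ v ∣)
    ... | inj₁ e = subst (Walk _~_ u v) (sym e) (short-way u v)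
    ... | inj₂ e = subst (Walk _~_ u v) (sym e) (long-way u v)

  alternatingᶜ : Alternating cycle
  alternatingᶜ {u} {w} t e = subst₂ Step (sym (d-C u t)) (sym (d-C w t)) (stepᶜ {u} {w} t e)

  -- Behaviour of distances around a cycle vertex.

  around : Fin n → Fin 3 → Fin n
  around v zero             = v
  around v (suc zero)       = proj₁ (successor v)
  around v (suc (suc zero)) = proj₁ (predecessor v)

  module _ (v : Fin n) where
    private
      w u : Fin n
      w = proj₁ (successor v)
      u = proj₁ (predecessor v)

    v~w : v ~ w
    v~w = Next⇒adj v w (proj₂ (successor v))

    v~u : v ~ u
    v~u = ~-sym {u} {v} (Next⇒adj u v (proj₂ (predecessor v)))

    w≢u : w ≢ u
    w≢u e = Next-no-2-cycle (proj₂ (successor v)) (subst (λ x → Next (toℕ x) (toℕ v)) (sym e) (proj₂ (predecessor v)))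

    star₂ᶜ : Star cycle v 2
    star₂ᶜ = pair {cycle} {v} {w} {u} w≢u v~w v~u

    around-injective : Injective _≡_ _≡_ (around v)
    around-injective {zero}           {zero}           _ = refl
    around-injective {zero}           {suc zero}       e = contradiction (subst (v ~_) (sym e) v~w) (~-irrefl {v})
    around-injective {zero}           {suc (suc zero)} e = contradiction (subst (v ~_) (sym e) v~u) (~-irrefl {v})
    around-injective {suc zero}       {zero}           e = contradiction (subst (v ~_) e v~w) (~-irrefl {v})
    around-injective {suc zero}       {suc zero}       _ = refl
    around-injective {suc zero}       {suc (suc zero)} e = contradiction e w≢u
    around-injective {suc (suc zero)} {zero}           e = contradiction (subst (v ~_) e v~u) (~-irrefl {v})
    around-injective {suc (suc zero)} {suc zero}       e = contradiction (sym e) w≢u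
    around-injective {suc (suc zero)} {suc (suc zero)} _ = refl

  -- Seen from v, the distance to t turns exactly when t is v or its antipode.
  Fits : Shape → Fin n → Fin n → Set
  Fits turn v t = D v t ≡ 0 ⊎ D v t ≡ h
  Fits pass v t = D v t ≢ 0 × D v t ≢ h

  turn-sym : ∀ v t → Fits turn v t → Fits turn t v
  turn-sym v t = subst (λ x → x ≡ 0 ⊎ x ≡ h) (D-sym v t)

  excludes : ∀ v t → Fits pass v t → ¬ Fits turn v t
  excludes v t (≢0 , ≢h) = Sum.[ ≢0 , ≢h ]

  -- The `suc` in `law` matches the shift of `level` by one.
  record Profile (s : Shape) (v t : Fin n) : Set where
    constructor mk-profile
    field
      σ    : Bit
      fits : Fits s v t
      law  : ∀ p → suc (D (around v p) t) ≡ D v t + level s σ p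

  -- The steps into and out of `v` decide the shape: rising then falling puts `v` at the antipode of
  -- `t`, falling then rising at `t`, and two equal signs mean `pass`.
  profile : ∀ v t → ∃[ s ] Profile s v t
  profile v t =
    let u , u→v = predecessor v
        w , v→w = successor v
        sᵤ , sᵤ<n , oᵤ = offset (toℕ<n t) (toℕ<n u)
        sᵥ , sᵥ<n , e , oᵥ = Next-offset (toℕ<n t) (toℕ<n v) sᵤ<n u→v oᵤ
        _  , s<n  , f , o  = Next-offset (toℕ<n t) (toℕ<n w) sᵥ<n v→w oᵥ
    in classify e (Offset-arc sᵤ<n oᵤ) (Offset-arc sᵥ<n oᵥ) (Offset-arc s<n o)
         (arc-step sᵤ<n e) (arc-step sᵥ<n f)
    where
    w u : Fin n
    w = proj₁ (successor v)
    u = proj₁ (predecessor v)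

    centre : suc (D v t) ≡ D v t + 1
    centre = +-comm 1 (D v t)

    farther : ∀ {x y} → x ≡ suc y → suc x ≡ y + 2
    farther {y = y} refl = +-comm 2 y

    nearer : ∀ {x y} → y ≡ suc x → suc x ≡ y + 0
    nearer {y = y} e = trans (sym e) (sym (+-identityʳ y))

    classify : ∀ {sᵤ sᵥ s} → Next sᵤ sᵥ →
      D u t ≡ arc sᵤ → D v t ≡ arc sᵥ → D w t ≡ arc s →
      (sᵤ < h × arc sᵥ ≡ suc (arc sᵤ)) ⊎ (h ≤ sᵤ × arc sᵤ ≡ suc (arc sᵥ)) →
      (sᵥ < h × arc s ≡ suc (arc sᵥ)) ⊎ (h ≤ sᵥ × arc sᵥ ≡ suc (arc s)) →
      ∃[ s ] Profile s v t
    classify {sᵥ = sᵥ} e dᵤ dᵥ d (inj₁ (sᵤ<h , a)) (inj₁ (sᵥ<h , b)) =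
      pass , mk-profile (suc zero)
      ((λ z → 0≢1+n (trans (sym z) (trans dᵥ a))) ,
       (λ z → <⇒≢ sᵥ<h (trans (sym (arc-near (<⇒≤ sᵥ<h))) (trans (sym dᵥ) z))))
      (λ { zero → centre
        ; (suc zero) → farther (trans d (trans b (cong suc (sym dᵥ))))
        ; (suc (suc zero)) → nearer (trans dᵥ (trans a (cong suc (sym dᵤ)))) })
    classify {sᵥ = sᵥ} e dᵤ dᵥ d (inj₁ (sᵤ<h , a)) (inj₂ (h≤sᵥ , b)) =
      turn , mk-profile zero (inj₂ (trans dᵥ (trans (cong arc (antipodal e)) (arc-near ≤-refl))))
      (λ { zero → centre
        ; (suc zero) → nearer (trans dᵥ (trans b (cong suc (sym d))))
        ; (suc (suc zero)) → nearer (trans dᵥ (trans a (cong suc (sym dᵤ)))) })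
      where
      antipodal : Next _ sᵥ → sᵥ ≡ h
      antipodal (inj₁ refl)    = ≤-antisym sᵤ<h h≤sᵥ
      antipodal (inj₂ (_ , refl)) = contradiction (≤-trans 2≤h h≤sᵥ) λ ()
    classify {sᵥ = sᵥ} e dᵤ dᵥ d (inj₂ (h≤sᵤ , a)) (inj₁ (sᵥ<h , b)) =
      turn , mk-profile (suc zero) (inj₁ (trans dᵥ (cong arc (equal e))))
      (λ { zero → centre
        ; (suc zero) → farther (trans d (trans b (cong suc (sym dᵥ))))
        ; (suc (suc zero)) → farther (trans dᵤ (trans a (cong suc (sym dᵥ)))) })
      where
      equal : Next _ sᵥ → sᵥ ≡ 0
      equal (inj₁ refl)    = contradiction (m≤n⇒m≤1+n h≤sᵤ) (<⇒≱ sᵥ<h)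
      equal (inj₂ (_ , z)) = z
    classify {sᵤ} e dᵤ dᵥ d (inj₂ (h≤sᵤ , a)) (inj₂ (h≤sᵥ , b)) =
      pass , mk-profile zero
      ((λ z → 0≢1+n (trans (sym z) (trans dᵥ b))) ,
       -- If `D v t` were `h`, the predecessor would be at distance `h + 1`.
       (λ z → <⇒≱ ≤-refl (subst (_≤ h) (trans a (cong suc (trans (sym dᵥ) z))) arc≤h)))
      (λ { zero → centre
        ; (suc zero) → nearer (trans dᵥ (trans b (cong suc (sym d))))
        ; (suc (suc zero)) → farther (trans dᵤ (trans a (cong suc (sym dᵥ)))) })
      where
      arc≤h : arc sᵤ ≤ h
      arc≤h = subst (_≤ h) (sym (arc-far h≤sᵤ)) (m≤n+o⇒m∸n≤o n sᵤ (+-monoˡ-≤ h h≤sᵤ))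

  -- `arc` is injective on each half, so equal values force `a < h < b`. The value 0 occurs only at
  -- offset 0; otherwise moving the origin from 0 to 1 brings `a` nearer and takes `b` farther away.
  arc-separates-< : ∀ {a b} → a < b → b < n → arc a ≡ arc b → arc ∣ a - 1 ∣ ≢ arc ∣ b - 1 ∣
  arc-separates-< {a} {b} a<b b<n e e′ with ≤-<-connex b h | ≤-<-connex h a
  ... | inj₁ b≤h | _ = <⇒≢ a<b (trans (sym (arc-near (≤-trans (<⇒≤ a<b) b≤h))) (trans e (arc-near b≤h)))
  ... | inj₂ h<b | inj₁ h≤a = <⇒≢ a<b (∸-cancelˡ-≡ (<⇒≤ (<-trans a<b b<n)) (<⇒≤ b<n)
        (trans (sym (arc-far h≤a)) (trans e (arc-far (<⇒≤ h<b)))))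
  arc-separates-< {zero} {b} a<b b<n e e′ | inj₂ h<b | inj₂ a<h =
    <⇒≢ (m<n⇒0<n∸m b<n) (trans e (arc-far (<⇒≤ h<b)))
  arc-separates-< {suc i} {suc j} a<b b<n e e′ | inj₂ (s≤s h≤j) | inj₂ a<h = <⇒≢ (n≤1+n (suc i)) (begin
    i              ≡⟨ arc-near (≤-trans (n≤1+n i) (<⇒≤ a<h)) ⟨
    arc i          ≡⟨ cong arc (∣-∣-identityʳ i) ⟨
    arc ∣ i - 0 ∣  ≡⟨ e′ ⟩
    arc ∣ j - 0 ∣  ≡⟨ cong arc (∣-∣-identityʳ j) ⟩
    arc j          ≡⟨ arc-far h≤j ⟩
    n ∸ j          ≡⟨ +-∸-assoc 1 (<⇒≤ b<n) ⟩
    suc (n ∸ suc j) ≡⟨ cong suc (arc-far (m≤n⇒m≤1+n h≤j)) ⟨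
    suc (arc (suc j)) ≡⟨ cong suc e ⟨
    suc (arc (suc i)) ≡⟨ cong suc (arc-near (<⇒≤ a<h)) ⟩
    suc (suc i)    ∎)
    where open ≡-Reasoning

  arc-separates : ∀ {a b} → a < n → b < n → arc a ≡ arc b → arc ∣ a - 1 ∣ ≡ arc ∣ b - 1 ∣ → a ≡ b
  arc-separates {a} {b} a<n b<n e e′ with <-cmp a b
  ... | tri< a<b _ _ = contradiction e′ (arc-separates-< a<b b<n e)
  ... | tri≈ _ a≡b _ = a≡b
  ... | tri> _ _ b<a = contradiction (sym e′) (arc-separates-< b<a a<n (sym e))

  1<n : 1 < n
  1<n = ≤-trans (s≤s (s≤s z≤n)) 4≤n

  vertex₀ vertex₁ : Fin n
  vertex₀ = fromℕ< 0<n
  vertex₁ = fromℕ< 1<n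

  vertex₀≢vertex₁ : vertex₀ ≢ vertex₁
  vertex₀≢vertex₁ e with () ← trans (sym (toℕ-fromℕ< 0<n)) (trans (cong toℕ e) (toℕ-fromℕ< 1<n))

  D-separates : ∀ a b → D a vertex₀ ≡ D b vertex₀ → D a vertex₁ ≡ D b vertex₁ → a ≡ b
  D-separates a b e₀ e₁ = toℕ-injective (arc-separates (toℕ<n a) (toℕ<n b)
    (trans (sym (at₀ a)) (trans e₀ (at₀ b))) (trans (sym (at₁ a)) (trans e₁ (at₁ b))))
    where
    at₀ : ∀ x → D x vertex₀ ≡ arc (toℕ x)
    at₀ x = cong arc (trans (cong ∣ toℕ x -_∣ (toℕ-fromℕ< 0<n)) (∣-∣-identityʳ (toℕ x)))
    at₁ : ∀ x → D x vertex₁ ≡ arc ∣ toℕ x - 1 ∣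
    at₁ x = cong (λ y → arc ∣ toℕ x - y ∣) (toℕ-fromℕ< 1<n)

-- Recovering a path coordinate from opposite ends.

-- `c` and `e` are meant as distances to the two ends of a path, with constant sum. The first two
-- equations give equal differences, hence equal doubles; the common summand avoids subtraction.
squeeze : ∀ {X X′ c c′ e e′} → X + c ≡ X′ + c′ → X + e ≡ X′ + e′ → c + e ≡ c′ + e′ → c ≡ c′
squeeze {X} {X′} {c} {c′} {e} {e′} p q s = *-cancelˡ-≡ c c′ 2
  (+-cancelʳ-≡ (X + e + e′ + X′) (2 * c) (2 * c′) (begin
  2 * c + (X + e + e′ + X′)       ≡⟨ shuffle c X e e′ X′ ⟩
  (X + c) + (c + e) + (X′ + e′)   ≡⟨ cong₂ _+_ (cong₂ _+_ p s) (sym q) ⟩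
  (X′ + c′) + (c′ + e′) + (X + e) ≡⟨ shuffle′ c′ X e e′ X′ ⟩
  2 * c′ + (X + e + e′ + X′)      ∎))
  where
  open ≡-Reasoning
  shuffle : ∀ c X e e′ X′ → 2 * c + (X + e + e′ + X′) ≡ (X + c) + (c + e) + (X′ + e′)
  shuffle = solve-∀
  shuffle′ : ∀ c X e e′ X′ → (X′ + c) + (c + e′) + (X + e) ≡ 2 * c + (X + e + e′ + X′)
  shuffle′ = solve-∀

∣-∣-ends : ∀ {l} (x : Fin (suc l)) → ∣ toℕ x - 0 ∣ + ∣ toℕ x - l ∣ ≡ l
∣-∣-ends {l} x = trans (cong₂ _+_ (∣-∣-identityʳ (toℕ x)) (m≤n⇒∣m-n∣≡n∸m x≤l)) (m+[n∸m]≡n x≤l)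
  where
  x≤l : toℕ x ≤ l
  x≤l = ≤-pred (toℕ<n x)

-- The product graph.

module Prism (h : ℕ) (2≤h : 2 ≤ h) (k m : ℕ) where
  open EvenCycle h 2≤h

  Γ : Graph
  Γ = (cycle □ P (2 + k)) □ P (2 + m)

  open Graph Γ using (Vertex)

  d-Γ : ∀ a b c a′ b′ c′ →
        d Γ ((a , b) , c) ((a′ , b′) , c′) ≡ D a a′ + ∣ toℕ b - toℕ b′ ∣ + ∣ toℕ c - toℕ c′ ∣
  d-Γ a b c a′ b′ c′ = trans (d-□ {cycle □ P (2 + k)} {P (2 + m)} (a , b) c (a′ , b′) c′)
    (cong₂ _+_ (trans (d-□ {cycle} {P (2 + k)} a b a′ b′) (cong₂ _+_ (d-C a a′) (d-P b b′))) (d-P c c′))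

  alternating-Γ : Alternating Γ
  alternating-Γ = alternating-□ {cycle □ P (2 + k)} {P (2 + m)}
    (alternating-□ {cycle} {P (2 + k)} (λ {u} {w} → alternatingᶜ {u} {w}) (λ {u} {w} → alternatingᴾ (2 + k) {u} {w}))
    (λ {u} {w} → alternatingᴾ (2 + m) {u} {w})

  -- Three landmarks never resolve.

  Corner : Vertex → Set
  Corner ((_ , b) , c) = End b × End c

  -- The cycle contributes two neighbours, an inner path vertex two more, and the other path at
  -- least one.
  corner-or-star₅ : ∀ q → Corner q ⊎ Star Γ q 5
  corner-or-star₅ ((a , b) , c) with end-or-star₂ᴾ b | end-or-star₂ᴾ c
  ... | inj₁ eb | inj₁ ec = inj₁ (eb , ec)
  ... | inj₂ st | _ = inj₂ (star-□ {cycle □ P (2 + k)} {P (2 + m)}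
        (star-□ {cycle} {P (2 + k)} (star₂ᶜ a) st) (star₁ᴾ c))
  ... | inj₁ _ | inj₂ st = inj₂ (star-□ {cycle □ P (2 + k)} {P (2 + m)}
        (star-□ {cycle} {P (2 + k)} (star₂ᶜ a) (star₁ᴾ b)) st)

  site : Fin n → Point → Vertex
  site v (p , b , c) = (around v p , b ↑ˡ k) , c ↑ˡ m

  site-injective : ∀ v → Injective _≡_ _≡_ (site v)
  site-injective v {p , b , c} {p′ , b′ , c′} e = cong₂ _,_
    (around-injective v (cong (proj₁ ∘ proj₁) e))
    (cong₂ _,_ (Fin.↑ˡ-injective k b b′ (cong (proj₂ ∘ proj₁) e)) (Fin.↑ˡ-injective m c c′ (cong proj₂ e)))

  angle : Vertex → Fin n
  angle ((a , _) , _) = a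

  -- The data of a landmark that do not depend on a cycle vertex, so that they combine with profiles
  -- at different vertices.
  record Bearing (q : Vertex) : Set where
    constructor mk-bearing
    field
      β γ    : Bit
      base   : ℕ
      law    : ∀ a b c → d Γ ((a , b ↑ˡ k) , c ↑ˡ m) q ≡
                         D a (angle q) + (base + bit (β ⊕ b) + bit (γ ⊕ c))

  bearing : ∀ {q} → Corner q → Bearing q
  bearing {(t , y) , z} (end-y , end-z) =
    let B , β , fb = end-profile end-y
        E , γ , fc = end-profile end-z
    in mk-bearing β γ (B + E) λ a b c → trans (d-Γ a (b ↑ˡ k) (c ↑ˡ m) t y z)
         (trans (cong₂ (λ x w → D a t + x + w) (fb b) (fc c)) (shuffle (D a t) B E _ _))
    where
    shuffle : ∀ x B E b c → x + (B + b) + (E + c) ≡ x + (B + E + b + c)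
    shuffle = solve-∀

  landmark : ∀ {q s v} → Bearing q → Profile s v (angle q) → Landmark
  landmark o f = Profile.σ f , Bearing.β o , Bearing.γ o

  -- Up to a constant independent of the point, `height` is the distance, so clashes yield equal
  -- distances.
  d-height : ∀ {q s v} (o : Bearing q) (f : Profile s v (angle q)) x →
    suc (d Γ (site v x) q) ≡ D v (angle q) + Bearing.base o + height s (landmark o f) x
  d-height {q} {s} {v} (mk-bearing β γ B law) (mk-profile σ _ law′) (p , b , c) =
    trans (cong suc (law (around v p) b c))
      (trans (cong (_+ (B + bit (β ⊕ b) + bit (γ ⊕ c))) (law′ p))
        (shuffle (D v (angle q)) (level s σ p) B (bit (β ⊕ b)) (bit (γ ⊕ c))))
    where
    shuffle : ∀ a l B b c → a + l + (B + b + c) ≡ a + B + (l + b + c)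
    shuffle = solve-∀

  height⇒d : ∀ {q s v} (o : Bearing q) (f : Profile s v (angle q)) x y →
    height s (landmark o f) x ≡ height s (landmark o f) y → d Γ (site v x) q ≡ d Γ (site v y) q
  height⇒d {q} {v = v} o f x y e = suc-injective
    (trans (d-height o f x) (trans (cong (D v (angle q) + Bearing.base o +_) e) (sym (d-height o f y))))

  clash⇒unresolved : ∀ {q₁ q₂ q₃ v s₁ s₂ s₃} (o₁ : Bearing q₁) (o₂ : Bearing q₂) (o₃ : Bearing q₃)
    (f₁ : Profile s₁ v (angle q₁)) (f₂ : Profile s₂ v (angle q₂)) (f₃ : Profile s₃ v (angle q₃)) →
    Clash s₁ s₂ s₃ (landmark o₁ f₁) (landmark o₂ f₂) (landmark o₃ f₃) → Unresolved Γ q₁ q₂ q₃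
  clash⇒unresolved {v = v} o₁ o₂ o₃ f₁ f₂ f₃ (x , y , x≢y , e₁ , e₂ , e₃) =
    unresolved-pair (site v x) (site v y) (x≢y ∘ site-injective v)
      (height⇒d o₁ f₁ x y e₁) (height⇒d o₂ f₂ x y e₂) (height⇒d o₃ f₃ x y e₃)

  profile-self : ∀ v → Profile turn v v
  profile-self v with profile v v
  ... | turn , f = f
  ... | pass , f = contradiction (D-refl v) (proj₁ (Profile.fits f))

  -- Around the cycle coordinate of `q₁` the only obstruction makes the skew of `q₁` differ from a
  -- common skew of `q₂` and `q₃`. Around that of `q₂` it would need `q₁` and `q₃` to share a skew,
  -- so the two obstructions exclude each other.
  bearings-unresolved : ∀ {q₁ q₂ q₃} → Bearing q₁ → Bearing q₂ → Bearing q₃ → Unresolved Γ q₁ q₂ q₃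
  bearings-unresolved {q₁} {q₂} {q₃} o₁ o₂ o₃ =
    at-q₁ (profile (angle q₁) (angle q₂)) (profile (angle q₁) (angle q₃))
    where
    f₁ : Profile turn (angle q₁) (angle q₁)
    f₁ = profile-self (angle q₁)

    g₂ : Profile turn (angle q₂) (angle q₂)
    g₂ = profile-self (angle q₂)

    at-q₂ : Fits pass (angle q₁) (angle q₂) →
            Bearing.β o₁ ⊕ Bearing.γ o₁ ≢ Bearing.β o₂ ⊕ Bearing.γ o₂ →
            Bearing.β o₂ ⊕ Bearing.γ o₂ ≡ Bearing.β o₃ ⊕ Bearing.γ o₃ →
            ∃[ s ] Profile s (angle q₂) (angle q₁) → ∃[ s ] Profile s (angle q₂) (angle q₃) →
            Unresolved Γ q₁ q₂ q₃
    -- Being equal or antipodal is symmetric, and `q₂` is neither as seen from `q₁`.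
    at-q₂ fit _ _ (turn , g₁) _ = contradiction
      (turn-sym (angle q₂) (angle q₁) (Profile.fits g₁))
      (excludes (angle q₁) (angle q₂) fit)
    at-q₂ _ _ _ (pass , g₁) (turn , g₃) = swap₁₂ Γ (swap₂₃ Γ (clash⇒unresolved o₂ o₃ o₁ g₂ g₃ g₁
      (turn-turn-pass (landmark o₂ g₂) (landmark o₃ g₃) (landmark o₁ g₁))))
    at-q₂ _ skew₁≢skew₂ skew₂≡skew₃ (pass , g₁) (pass , g₃) = Sum.[
        (λ clash → swap₁₂ Γ (clash⇒unresolved o₂ o₁ o₃ g₂ g₁ g₃ clash)) ,
        (λ (_ , skew₁≡skew₃) → contradiction (trans skew₁≡skew₃ (sym skew₂≡skew₃)) skew₁≢skew₂)
      ] (turn-pass-pass (landmark o₂ g₂) (landmark o₁ g₁) (landmark o₃ g₃))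

    at-q₁ : ∃[ s ] Profile s (angle q₁) (angle q₂) → ∃[ s ] Profile s (angle q₁) (angle q₃) →
            Unresolved Γ q₁ q₂ q₃
    at-q₁ (turn , f₂) (turn , f₃) = clash⇒unresolved o₁ o₂ o₃ f₁ f₂ f₃
      (turn-turn-turn (landmark o₁ f₁) (landmark o₂ f₂) (landmark o₃ f₃))
    at-q₁ (turn , f₂) (pass , f₃) = clash⇒unresolved o₁ o₂ o₃ f₁ f₂ f₃
      (turn-turn-pass (landmark o₁ f₁) (landmark o₂ f₂) (landmark o₃ f₃))
    at-q₁ (pass , f₂) (turn , f₃) = swap₂₃ Γ (clash⇒unresolved o₁ o₃ o₂ f₁ f₃ f₂
      (turn-turn-pass (landmark o₁ f₁) (landmark o₃ f₃) (landmark o₂ f₂)))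
    at-q₁ (pass , f₂) (pass , f₃) = Sum.[
        clash⇒unresolved o₁ o₂ o₃ f₁ f₂ f₃ ,
        (λ (skew₁≢skew₂ , skew₂≡skew₃) → at-q₂ (Profile.fits f₂) skew₁≢skew₂ skew₂≡skew₃
          (profile (angle q₂) (angle q₁)) (profile (angle q₂) (angle q₃)))
      ] (turn-pass-pass (landmark o₁ f₁) (landmark o₂ f₂) (landmark o₃ f₃))

  unresolved : ∀ q₁ q₂ q₃ → Unresolved Γ q₁ q₂ q₃
  unresolved q₁ q₂ q₃ = go (corner-or-star₅ q₁) (corner-or-star₅ q₂) (corner-or-star₅ q₃)
    where
    go : Corner q₁ ⊎ Star Γ q₁ 5 → Corner q₂ ⊎ Star Γ q₂ 5 → Corner q₃ ⊎ Star Γ q₃ 5 →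
         Unresolved Γ q₁ q₂ q₃
    go (inj₁ c₁) (inj₁ c₂) (inj₁ c₃) =
      bearings-unresolved (bearing {q₁} c₁) (bearing {q₂} c₂) (bearing {q₃} c₃)
    go (inj₂ st) _         _         = crowded Γ alternating-Γ st q₂ q₃
    go (inj₁ _)  (inj₂ st) _         = swap₁₂ Γ (crowded Γ alternating-Γ st q₁ q₃)
    go (inj₁ _)  (inj₁ _)  (inj₂ st) = swap₂₃ Γ (swap₁₂ Γ (crowded Γ alternating-Γ st q₁ q₂))

  -- Shorter lists are padded to three landmarks by repetition, the empty one by an arbitrary
  -- vertex.
  dimension-≥4 : ∀ Q → IsResolvingSet Γ Q → 4 ≤ length Q
  dimension-≥4 [] (_ , res) =
    let q = (vertex₀ , zero) , zero
        unresolved-pair x y x≢y _ _ _ = unresolved q q q in contradiction refl (res x y x≢y)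
  dimension-≥4 (q₁ ∷ []) (_ , res) =
    let unresolved-pair x y x≢y e₁ _ _ = unresolved q₁ q₁ q₁ in contradiction (cong (_∷ []) e₁) (res x y x≢y)
  dimension-≥4 (q₁ ∷ q₂ ∷ []) (_ , res) =
    let unresolved-pair x y x≢y e₁ e₂ _ = unresolved q₁ q₂ q₂
    in contradiction (cong₂ _∷_ e₁ (cong (_∷ []) e₂)) (res x y x≢y)
  dimension-≥4 (q₁ ∷ q₂ ∷ q₃ ∷ []) (_ , res) =
    let unresolved-pair x y x≢y e₁ e₂ e₃ = unresolved q₁ q₂ q₃
    in contradiction (cong₂ _∷_ e₁ (cong₂ _∷_ e₂ (cong (_∷ []) e₃))) (res x y x≢y)
  dimension-≥4 (_ ∷ _ ∷ _ ∷ _ ∷ _) _ = s≤s (s≤s (s≤s (s≤s z≤n)))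

  -- A resolving set of four vertices.

  -- A corner, its translates to the far end of the second and of the first path, and its neighbour
  -- on the cycle.
  basis : List Vertex
  basis = ((vertex₀ , zero) , zero)
        ∷ ((vertex₀ , zero) , fromℕ (suc m))
        ∷ ((vertex₀ , fromℕ (suc k)) , zero)
        ∷ ((vertex₁ , zero) , zero)
        ∷ []

  basis-unique : Unique basis
  basis-unique = ((λ ()) ∷ (λ ()) ∷ (λ e → vertex₀≢vertex₁ (cong angle e)) ∷ [])
    ∷ ((λ ()) ∷ (λ ()) ∷ []) ∷ ((λ ()) ∷ []) ∷ [] ∷ []

  basis-resolves : ∀ x y → r Γ x basis ≡ r Γ y basis → x ≡ y
  basis-resolves ((a , b) , c) ((a′ , b′) , c′) e =
    let e₁ , e′ = ∷-injective e
        e₂ , e″ = ∷-injective e′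
        e₃ , e‴ = ∷-injective e″
        e₄ , _  = ∷-injective e‴
        p₁ = coordinates vertex₀ zero zero e₁
        p₂ = coordinates vertex₀ zero (fromℕ (suc m)) e₂
        p₃ = coordinates vertex₀ (fromℕ (suc k)) zero e₃
        p₄ = coordinates vertex₁ zero zero e₄
        -- The first two landmarks differ only in the end of the second path.
        c≡ = squeeze p₁ p₂ (ends c c′)
        q₁ = cancel c≡ p₁
        -- With `c` cancelled, the first and third landmarks do the same for the first path.
        b≡ = squeeze q₁ (cancel c≡ p₃) (ends b b′)
    in cong₂ _,_
         (cong₂ _,_ (D-separates a a′ (cancel b≡ q₁) (cancel b≡ (cancel c≡ p₄))) (from-0 b≡))
         (from-0 c≡)
    where
    coordinates : ∀ s t u → d Γ ((a , b) , c) ((s , t) , u) ≡ d Γ ((a′ , b′) , c′) ((s , t) , u) →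
      D a s + ∣ toℕ b - toℕ t ∣ + ∣ toℕ c - toℕ u ∣ ≡ D a′ s + ∣ toℕ b′ - toℕ t ∣ + ∣ toℕ c′ - toℕ u ∣
    coordinates s t u e = trans (sym (d-Γ a b c s t u)) (trans e (d-Γ a′ b′ c′ s t u))

    ends : ∀ {l} (x y : Fin (suc l)) →
      ∣ toℕ x - 0 ∣ + ∣ toℕ x - toℕ (fromℕ l) ∣ ≡ ∣ toℕ y - 0 ∣ + ∣ toℕ y - toℕ (fromℕ l) ∣
    ends {l} x y rewrite Fin.toℕ-fromℕ l = trans (∣-∣-ends x) (sym (∣-∣-ends y))

    cancel : ∀ {x x′ y y′} → y ≡ y′ → x + y ≡ x′ + y′ → x ≡ x′
    cancel {x} {x′} {y} refl = +-cancelʳ-≡ y x x′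

    from-0 : ∀ {l} {x y : Fin l} → ∣ toℕ x - 0 ∣ ≡ ∣ toℕ y - 0 ∣ → x ≡ y
    from-0 {x = x} {y} e = toℕ-injective (trans (sym (∣-∣-identityʳ (toℕ x))) (trans e (∣-∣-identityʳ (toℕ y))))

  dimension : IsMetricDimension Γ 4
  dimension = (basis , (basis-unique , λ x y x≢y → x≢y ∘ basis-resolves x y) , refl) , dimension-≥4

theorem3p4 : (n k m : ℕ) (4≤n : 4 ≤ n) → 2 ∣ n → 3 ≤ k → 2 ≤ m →
    IsMetricDimension ((C n (≤-trans (n≤1+n 3) 4≤n) □ P k) □ P m) 4
theorem3p4 n (suc (suc k)) (suc (suc m)) 4≤n (divides h n≡h*2) _ _ =
  halved n h (trans n≡h*2 (twice h)) 4≤n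
  where
  twice : ∀ h → h * 2 ≡ h + h
  twice = solve-∀

  2≤half : ∀ h → 4 ≤ h + h → 2 ≤ h
  2≤half (suc zero)    (s≤s (s≤s ()))
  2≤half (suc (suc h)) _ = s≤s (s≤s z≤n)

  -- With `n` a variable, matching on `refl` replaces it by `h + h`. The bound taken by `C` is
  -- irrelevant, so this cycle is the one of `Prism`.
  halved : ∀ n h → n ≡ h + h → (4≤n : 4 ≤ n) →
    IsMetricDimension ((C n (≤-trans (n≤1+n 3) 4≤n) □ P (2 + k)) □ P (2 + m)) 4
  halved _ h refl 4≤n = Prism.dimension h (2≤half h 4≤n) k m
theorem3p4 _ _ (suc zero) _ _ _ (s≤s ())
theorem3p4 _ (suc zero) _ _ _ (s≤s ()) _
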